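{- Fix a positive integer $n$. A set of primes with exactly two elements admits a 4-cycle if any of the following hold: (1) it is of the form $\{p,p+2\}$ with $p$ and $p+2$ both prime; (2) it is of the form $\{p,p^n-2\}$ with $p$ and $p^n-2$ both prime; (3) it is of the form $\{p,2p+1\}$ with $p$ and $2p+1$ both prime.
   Context: A set of primes $\{p_1,\dots,p_k\}$ is said to admit a 4-cycle if there exist signs $\epsilon_1,\epsilon_2,\epsilon_3,\epsilon_4\in\{ -1,1\}$ and integers $u_i=p_1^{a_{i1}}\cdots p_k^{a_{ik}}$ ($1\le i\le 4$), with every $a_{ij}$ a nonnegative integer, such that $\epsilon_1u_1+\epsilon_2u_2+\epsilon_3u_3+\epsilon_4u_4=0$ and no proper nonempty subsum vanishes (i.e. $\sum_{i\in I}\epsilon_iu_i\neq 0$ for every $\emptyset\ne I\subsetneq\{1,2,3,4\}$). The $u_i$ need not be distinct. -}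

module Defs where

open import Data.Bool using (if_then_else_)
open import Data.Fin using (Fin)
open import Data.Fin.Subset using (Subset; Nonempty; _⊂_; ⊤)
open import Data.Integer using (ℤ; 0ℤ; _+_; _◃_)
open import Data.Nat using (ℕ; _*_; _^_)
open import Data.Nat.Primality using (Prime)
open import Data.Product using (_×_; Σ-syntax)
open import Data.Sign using (Sign)
open import Data.Vec using (Vec; lookup; zipWith; foldr′)
import Data.Vec.Functional as Vector
open import Data.Vec.Membership.Propositional using () renaming (_∈_ to _∈ᵛ_)
open import Data.Vec.Relation.Unary.All using (All)
open import Data.Vec.Relation.Unary.Unique.Propositional using (Unique)
open import Level using (0ℓ)
open import Relation.Binary.PropositionalEquality using (_≡_; _≢_)
open import Relation.Unary using (Pred; _≐_; _∪_; ｛_｝)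

-- A set of primes with exactly k elements, given by an enumeration without
-- repetition. The order of the enumeration plays no role in what follows.
record PrimeSet (k : ℕ) : Set where
  field
    elements  : Vec ℕ k
    distinct  : Unique elements
    allPrime  : All Prime elements

open PrimeSet public

Members : ∀ {k} → PrimeSet k → Pred ℕ 0ℓ
Members S x = x ∈ᵛ elements S

_isPair_and_ : ∀ {k} → PrimeSet k → ℕ → ℕ → Set
S isPair p and q = Members S ≐ (｛ p ｝ ∪ ｛ q ｝)

-- p₁ ^ a₁ * ⋯ * pₖ ^ aₖ
monomial : ∀ {k} → PrimeSet k → Vec ℕ k → ℕ
monomial S a = foldr′ _*_ 1 (zipWith _^_ (elements S) a)

subsum : ∀ {m} → Subset m → (Fin m → ℤ) → ℤ
subsum I t = Vector.foldr _+_ 0ℤ (λ i → if lookup I i then t i else 0ℤ)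

-- ε i ◃ u is the integer ε i · u.
AdmitsFourCycle : ∀ {k} → PrimeSet k → Set
AdmitsFourCycle {k} S =
  Σ[ ε ∈ (Fin 4 → Sign) ] Σ[ a ∈ (Fin 4 → Vec ℕ k) ]
    let term : Fin 4 → ℤ
        term i = ε i ◃ monomial S (a i)
    in  subsum ⊤ term ≡ 0ℤ
      × (∀ (I : Subset 4) → Nonempty I → I ⊂ ⊤ → subsum I term ≢ 0ℤ)

{-# OPTIONS --safe #-}

-- Each family gives a relation A = B + C + D between monomials in the two
-- primes: p + 2 = p + 1 + 1, pⁿ = (pⁿ − 2) + 1 + 1 and 2p + 1 = p + p + 1.
-- In A − B − C − D = 0 a nonempty subsum avoiding A is negative, and a proper
-- subsum containing A is the opposite of such a sum, hence positive.
module Submission where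

open import Data.Fin using (Fin; zero; suc)
open import Data.Fin.Subset
  using (Subset; inside; outside; _⊂_; Nonempty; ∁; ⊤)
open import Data.Fin.Subset.Properties using (x∉p⇒x∈∁p)
open import Data.Integer using (ℤ; 0ℤ; +_; -_; _◃_; -<+)
import Data.Integer as ℤ
import Data.Integer.Properties as ℤ
open import Data.Nat using (ℕ; zero; suc; _+_; _*_; _∸_; _^_; NonZero; ≢-nonZero⁻¹)
open import Data.Nat.Primality using (Prime; prime⇒nonZero)
open import Data.Nat.Properties
  using (+-assoc; +-identityʳ; *-identityˡ; *-identityʳ; m*n≢0; m^n≢0;
         m∸n≢0⇒n<m; m∸n+n≡m; <⇒≤)
open import Data.Product using (_×_; _,_; ∃-syntax)
open import Data.Sign using (Sign)
open import Data.Sum using (_⊎_; inj₁; inj₂)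
open import Data.Vec using (Vec; []; _∷_; there; replicate; lookup; zipWith; foldr′)
import Data.Vec.Functional as Vector
open import Data.Vec.Membership.Propositional using () renaming (_∈_ to _∈ᵛ_)
open import Data.Vec.Relation.Unary.All using (All; []; _∷_)
open import Data.Vec.Relation.Unary.Any as Any using ()
open import Function using (_∘_)
open import Relation.Binary.PropositionalEquality
  using (_≡_; _≢_; refl; sym; trans; cong; cong₂; subst; module ≡-Reasoning)
open import Defs

-- Each index contributes to exactly one of the two subsums. If the total is zero, a vanishing
-- subsum therefore forces its complementary subsum to vanish.
subsum-∁ : ∀ {m} (I : Subset m) (t : Fin m → ℤ) →
           subsum I t ℤ.+ subsum (∁ I) t ≡ subsum ⊤ t
subsum-∁ []            t = refl
subsum-∁ (inside ∷ I)  t = begin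
  (t zero ℤ.+ x) ℤ.+ (0ℤ ℤ.+ y) ≡⟨ cong (λ s → (t zero ℤ.+ x) ℤ.+ s) (ℤ.+-identityˡ y) ⟩
  (t zero ℤ.+ x) ℤ.+ y          ≡⟨ ℤ.+-assoc (t zero) x y ⟩
  t zero ℤ.+ (x ℤ.+ y)          ≡⟨ cong (λ s → t zero ℤ.+ s) (subsum-∁ I (t ∘ suc)) ⟩
  t zero ℤ.+ subsum ⊤ (t ∘ suc) ∎
  where
  open ≡-Reasoning
  x = subsum I (t ∘ suc)
  y = subsum (∁ I) (t ∘ suc)
subsum-∁ (outside ∷ I) t = begin
  (0ℤ ℤ.+ x) ℤ.+ (t zero ℤ.+ y) ≡⟨ cong (ℤ._+ (t zero ℤ.+ y)) (ℤ.+-identityˡ x) ⟩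
  x ℤ.+ (t zero ℤ.+ y)          ≡⟨ ℤ.+-assoc x (t zero) y ⟨
  (x ℤ.+ t zero) ℤ.+ y          ≡⟨ cong (ℤ._+ y) (ℤ.+-comm x (t zero)) ⟩
  (t zero ℤ.+ x) ℤ.+ y          ≡⟨ ℤ.+-assoc (t zero) x y ⟩
  t zero ℤ.+ (x ℤ.+ y)          ≡⟨ cong (λ s → t zero ℤ.+ s) (subsum-∁ I (t ∘ suc)) ⟩
  t zero ℤ.+ subsum ⊤ (t ∘ suc) ∎
  where
  open ≡-Reasoning
  x = subsum I (t ∘ suc)
  y = subsum (∁ I) (t ∘ suc)

subsum-nonpositive : ∀ {m} (I : Subset m) {t : Fin m → ℤ} →
                     (∀ i → t i ℤ.< 0ℤ) → subsum I t ℤ.≤ 0ℤ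
subsum-nonpositive []            t<0 = ℤ.≤-refl
subsum-nonpositive (inside ∷ I)  t<0 =
  ℤ.+-mono-≤ (ℤ.<⇒≤ (t<0 zero)) (subsum-nonpositive I (t<0 ∘ suc))
subsum-nonpositive (outside ∷ I) t<0 =
  ℤ.+-mono-≤ (ℤ.≤-refl {0ℤ}) (subsum-nonpositive I (t<0 ∘ suc))

-- One selected term already makes the sum strictly negative. The remaining selection may be empty,
-- so only the weak bound is asked of it.
subsum-negative : ∀ {m} (I : Subset m) {t : Fin m → ℤ} →
                  (∀ i → t i ℤ.< 0ℤ) → Nonempty I → subsum I t ℤ.< 0ℤ
subsum-negative (inside ∷ I)  t<0 _ =
  ℤ.+-mono-<-≤ (t<0 zero) (subsum-nonpositive I (t<0 ∘ suc))
subsum-negative (outside ∷ I) t<0 (suc i , there i∈I) =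
  ℤ.+-mono-≤-< (ℤ.≤-refl {0ℤ}) (subsum-negative I (t<0 ∘ suc) (i , i∈I))

module _ {m} {t : Fin (suc m) → ℤ} (t<0 : ∀ i → t (suc i) ℤ.< 0ℤ) where

  subsum-outside≢0 : (I : Subset m) → Nonempty (outside ∷ I) →
                     subsum (outside ∷ I) t ≢ 0ℤ
  subsum-outside≢0 I (suc i , there i∈I) =
    ℤ.<⇒≢ (ℤ.+-mono-≤-< (ℤ.≤-refl {0ℤ}) (subsum-negative I t<0 (i , i∈I)))

  properSubsum≢0 : subsum ⊤ t ≡ 0ℤ →
                   ∀ I → Nonempty I → I ⊂ ⊤ → subsum I t ≢ 0ℤ
  properSubsum≢0 total (outside ∷ I) I≢∅ _ = subsum-outside≢0 I I≢∅
  properSubsum≢0 total (inside ∷ I)  _ (_ , i , _ , i∉I) sum≡0 =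
    -- Properness of the subset yields an index `i` outside it. This `i` makes the complement
    -- nonempty, and the complement leaves out the first term.
    subsum-outside≢0 (∁ I) (i , x∉p⇒x∈∁p i∉I) (begin
      subsum (∁ J) t                   ≡⟨ ℤ.+-identityˡ _ ⟨
      0ℤ ℤ.+ subsum (∁ J) t            ≡⟨ cong (ℤ._+ subsum (∁ J) t) sum≡0 ⟨
      subsum J t ℤ.+ subsum (∁ J) t    ≡⟨ subsum-∁ J t ⟩
      subsum ⊤ t                       ≡⟨ total ⟩
      0ℤ                               ∎)
    where
    open ≡-Reasoning
    J = inside ∷ I

-- Collects the negative terms into one natural number, so that the relation between monomials can
-- be applied in ℕ.
subsum-⊤-neg : ∀ {m} (u : Fin m → ℕ) →
               subsum ⊤ (λ i → Sign.- ◃ u i) ≡ - (+ Vector.foldr _+_ 0 u)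
subsum-⊤-neg {zero} u = refl
subsum-⊤-neg {suc m}  u =
  trans (cong₂ ℤ._+_ (ℤ.-◃n≡-n (u zero)) (subsum-⊤-neg (u ∘ suc)))
        (sym (ℤ.neg-distrib-+ (+ u zero) (+ Vector.foldr _+_ 0 (u ∘ suc))))

-◃-negative : ∀ n .{{_ : NonZero n}} → Sign.- ◃ n ℤ.< 0ℤ
-◃-negative (suc n) = -<+

monomial≢0 : ∀ {k} (S : PrimeSet k) (a : Vec ℕ k) → NonZero (monomial S a)
monomial≢0 S = go (allPrime S)
  where
  -- The induction runs on the bare vector and its primality proofs, which pass directly to the
  -- tail.
  go : ∀ {k} {ps : Vec ℕ k} → All Prime ps → (a : Vec ℕ k) →
       NonZero (foldr′ _*_ 1 (zipWith _^_ ps a))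
  go []             []      = _
  go {ps = p ∷ ps} (pp ∷ pps) (e ∷ a) =
    m*n≢0 (p ^ e) _ {{m^n≢0 p e {{prime⇒nonZero pp}}}} {{go pps a}}

-- Hiding the exponent vector lets the three families be treated alike, whatever the order in which
-- `S` lists its primes.
IsMonomial : ∀ {k} → PrimeSet k → ℕ → Set
IsMonomial S u = ∃[ a ] monomial S a ≡ u

-- Put `e` at the position of `p` and 0 elsewhere. The case `e = 0` supplies the monomial 1.
member^-isMonomial : ∀ {k} (S : PrimeSet k) {p} → Members S p →
                     ∀ e → IsMonomial S (p ^ e)
member^-isMonomial S p∈S e = go p∈S
  where
  value : ∀ {k} → Vec ℕ k → Vec ℕ k → ℕ
  value ps a = foldr′ _*_ 1 (zipWith _^_ ps a)

  value-0 : ∀ {k} (ps : Vec ℕ k) → value ps (replicate k 0) ≡ 1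
  value-0 []       = refl
  value-0 (p ∷ ps) = trans (*-identityˡ _) (value-0 ps)

  go : ∀ {k} {ps : Vec ℕ k} {p} → p ∈ᵛ ps → ∃[ a ] value ps a ≡ p ^ e
  go {ps = p ∷ ps} (Any.here refl) =
    e ∷ replicate _ 0 , trans (cong (p ^ e *_) (value-0 ps)) (*-identityʳ (p ^ e))
  go (Any.there p∈ps) with a , eq ← go p∈ps =
    0 ∷ a , trans (*-identityˡ _) eq

member-isMonomial : ∀ {k} (S : PrimeSet k) {p} → Members S p → IsMonomial S p
member-isMonomial S {p} p∈S =
  subst (IsMonomial S) (*-identityʳ p) (member^-isMonomial S p∈S 1)

-- Take signs +, -, -, -. Monomials in primes are positive, so the last three terms are negative, as
-- `properSubsum≢0` requires. The right-nested sum follows the fold in `subsum`.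
fourCycle : ∀ {k} (S : PrimeSet k) {A B C D} →
            IsMonomial S A → IsMonomial S B → IsMonomial S C → IsMonomial S D →
            A ≡ B + (C + D) → AdmitsFourCycle S
fourCycle S {D = D} (a , refl) (b , refl) (c , refl) (d , refl) A≡B+C+D =
  ε , exponents , total ,
  properSubsum≢0 {t = term}
    (λ i → -◃-negative _ {{monomial≢0 S (exponents (suc i))}}) total
  where
  ε : Fin 4 → Sign
  ε zero    = Sign.+
  ε (suc _) = Sign.-

  exponents : Fin 4 → Vec ℕ _
  exponents = lookup (a ∷ b ∷ c ∷ d ∷ [])

  A = monomial S a
  B = monomial S b
  C = monomial S c

  term : Fin 4 → ℤ
  term i = ε i ◃ monomial S (exponents i)

  total : subsum ⊤ term ≡ 0ℤ
  total = begin
    _                                     ≡⟨ cong₂ ℤ._+_ (ℤ.+◃n≡+n A)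
                                               (subsum-⊤-neg (monomial S ∘ exponents ∘ suc)) ⟩
    -- The trailing `0` is the initial value of the fold.
    + A ℤ.+ (- (+ (B + (C + (D + 0)))))   ≡⟨ cong (λ x → + A ℤ.+ (- (+ (B + (C + x)))))
                                               (+-identityʳ D) ⟩
    + A ℤ.+ (- (+ (B + (C + D))))         ≡⟨ cong (λ x → + A ℤ.+ (- (+ x))) A≡B+C+D ⟨
    + A ℤ.+ (- (+ A))                     ≡⟨ ℤ.+-inverseʳ (+ A) ⟩
    0ℤ                                    ∎
    where open ≡-Reasoning

theorem1p5 : (n : ℕ) .{{_ : NonZero n}} (S : PrimeSet 2) →
    (∃[ p ] (Prime p × Prime (p + 2) × S isPair p and (p + 2)))
    ⊎ (∃[ p ] (Prime p × Prime (p ^ n ∸ 2) × S isPair p and (p ^ n ∸ 2)))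
    ⊎ (∃[ p ] (Prime p × Prime (2 * p + 1) × S isPair p and (2 * p + 1)))
    → AdmitsFourCycle S
theorem1p5 n S (inj₁ (p , _ , _ , _ , pair⊆S)) =
  fourCycle S (member-isMonomial S (pair⊆S (inj₂ refl))) (member-isMonomial S p∈S) one one refl
  where
  p∈S = pair⊆S (inj₁ refl)
  one = member^-isMonomial S p∈S 0
theorem1p5 n S (inj₂ (inj₁ (p , _ , q-prime , _ , pair⊆S))) =
  fourCycle S (member^-isMonomial S p∈S n) (member-isMonomial S (pair⊆S (inj₂ refl))) one one
    -- A prime is nonzero, so `p ^ n ∸ 2` is not truncated: 2 < `p ^ n`, and adding 2 back recovers
    -- `p ^ n`.
    (sym (m∸n+n≡m {n = 2} (<⇒≤ (m∸n≢0⇒n<m (≢-nonZero⁻¹ _ {{prime⇒nonZero q-prime}})))))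
  where
  p∈S = pair⊆S (inj₁ refl)
  one = member^-isMonomial S p∈S 0
theorem1p5 n S (inj₂ (inj₂ (p , _ , _ , _ , pair⊆S))) =
  fourCycle S (member-isMonomial S (pair⊆S (inj₂ refl)))
    (member-isMonomial S p∈S) (member-isMonomial S p∈S) (member^-isMonomial S p∈S 0)
    -- `2 * p + 1` unfolds to `(p + (p + 0)) + 1`; reassociating twice gives `p + (p + 1)`.
    (trans (+-assoc p (p + 0) 1) (cong (λ r → p + r) (+-assoc p 0 1)))
  where
  p∈S = pair⊆S (inj₁ refl)
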